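{- For all $n\ge 1$, let $f_0(n)$ be the number of permutations $\pi$ of $[n]$ such that $\pi(i-1)+\pi(i+1)-2\pi(i)\le 0$ for all $i\in\{2,3,\ldots,n-1\}$. Then $$f_0(n)=\begin{cases}1 & \text{if } n=1\\ 2 & \text{if } n=2\\ 4 & \text{if } n=3\\ 6 & \text{if } n=4\\ 8 & \text{if } n\ge 5.\end{cases}$$
   Context: $[n]=\{1,2,\ldots,n\}$; a permutation of length $n$ is a bijection $\pi:[n]\to[n]$. The condition is vacuous for $n\le 2$. -}

module Defs where

open import Data.Fin.Base using (Fin; toℕ)
open import Data.Fin.Permutation using (Permutation′; _⟨$⟩ʳ_)
open import Data.Integer.Base using (ℤ; +_; 0ℤ; _+_; _-_; _*_; _≤_)
open import Data.Nat.Base using (ℕ; suc)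
open import Data.Product.Base using (Σ; proj₁)
open import Function.Bundles using (Bijection)
open import Level using (0ℓ)
open import Relation.Binary.Bundles using (Setoid)
import Relation.Binary.Construct.On as On
open import Relation.Binary.PropositionalEquality using (_≡_; setoid; _→-setoid_)

-- Fin n is {0,…,n-1}; an element x stands for label x = toℕ x + 1 in
-- [n] = {1,…,n}, both as a position and as a value.
label : ∀ {n} → Fin n → ℕ
label x = suc (toℕ x)

-- The positions i-1, i, i+1 are h, i, j.  Requiring that h and j exist
-- restricts the position i to 2 ≤ i ≤ n-1.
SecondDifferences≤0 : ∀ {n} → Permutation′ n → Set
SecondDifferences≤0 {n} π =
  ∀ (h i j : Fin n) → label i ≡ suc (label h) → label j ≡ suc (label i) →
  (val h + val j) - + 2 * val i ≤ 0ℤ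
  where
  val : Fin n → ℤ
  val x = + label (π ⟨$⟩ʳ x)

-- Two permutations are equal when their forward maps agree pointwise:
-- without function extensionality, _≡_ would also compare the inverse maps
-- and the proofs stored in the records.
F₀ : ℕ → Setoid 0ℓ 0ℓ
F₀ n = On.setoid {B = Σ (Permutation′ n) SecondDifferences≤0}
                 (Fin n →-setoid Fin n) (λ p → proj₁ p ⟨$⟩ʳ_)

-- "f₀(n) = k": the collection F₀ n has exactly k elements.
f₀[_]≐_ : ℕ → ℕ → Set
f₀[ n ]≐ k = Bijection (setoid (Fin k)) (F₀ n)

{-# OPTIONS --safe #-}
-- In a concave permutation of {0,…,n-1} the value 0 sits at an end, so up to
-- reversal it comes first.  A concave permutation starting with 0 is 0
-- followed by 1 + r, where r is concave with r(1) ≤ 2 r(0) + 1.  Either r starts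
-- with 0, and then this bound forces the identity, or r is the reversal of a
-- concave permutation π of length n-1 starting with 0.  Hence the list for
-- length n+1 consists of the identity and of L π = 0 ∷ (1 + reverse π), where π
-- runs over those members of the list for length n whose reversal meets the
-- bound.  For n = 2, 3, 4 all of them do.  For n ≥ 5 the list is
-- id, L id, L (L id) and the zigzag L (L ω) = (0,2,4,…,5,3,1), and only
-- L (L id) = (0,2,3,…,n-1,1) fails.
module Submission where

open import Defs
open import Data.Fin.Base using (Fin; zero; suc; toℕ; fromℕ; inject₁; opposite)
open import Data.Fin.Permutation
  using (Permutation′; _⟨$⟩ʳ_; _⟨$⟩ˡ_; _≈_; id; reverse; remove; _∘ₚ_;
         lift₀; lift₀-id; lift₀-remove; lift₀-cong; inverseˡ; inverseʳ)
open import Data.Fin.Properties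
  using (toℕ-injective; toℕ-inject₁; toℕ≤pred[n]; opposite-involutive; suc-injective)
open import Data.Fin.Relation.Unary.Top using (view; ‵fromℕ; ‵inject₁)
open import Data.Integer.Base as ℤ using (+_; +≤+)
import Data.Integer.Properties as ℤ
open import Data.List.Base using (List; []; _∷_; _++_; map; length; lookup)
import Data.List.Membership.Setoid as Membership
open import Data.List.Membership.Propositional.Properties using (∈-lookup)
open import Data.List.Membership.Setoid.Properties
  using (∈-map⁺; ∈-map⁻; ∈-resp-≈; ∈-++⁺ˡ; ∈-++⁺ʳ)
open import Data.List.Relation.Binary.Disjoint.Setoid using (Disjoint)
open import Data.List.Relation.Unary.All as All using (All; []; _∷_)
import Data.List.Relation.Unary.All.Properties as All
open import Data.List.Relation.Unary.AllPairs using ([]; _∷_)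
open import Data.List.Relation.Unary.Any using (here; there; index)
open import Data.List.Relation.Unary.Any.Properties using (lookup-index)
open import Data.List.Relation.Unary.Unique.Setoid using (Unique)
import Data.List.Relation.Unary.Unique.Setoid.Properties as Unique
open import Data.Nat.Base
  using (ℕ; zero; suc; pred; _+_; _*_; _≤_; _≥_; z≤n; s≤s; s≤s⁻¹)
open import Data.Nat.Properties
  using (+-suc; *-suc; +-comm; ≤-trans; ≤-reflexive; m+n≡0⇒m≡0;
         n≤0⇒n≡0; n≤1+n; m≤n*m; 1+n≰n)
open import Data.Nat.Solver using (module +-*-Solver)
open import Data.Product.Base using (Σ; _×_; _,_; proj₁; proj₂)
open import Data.Sum.Base using (_⊎_; inj₁; inj₂)
open import Function.Base using (_∘_; case_of_)
open import Level using (0ℓ)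
open import Relation.Binary.Bundles using (Setoid)
import Relation.Binary.Construct.On as On
open import Relation.Binary.PropositionalEquality
  using (_≡_; _≢_; refl; sym; trans; cong; cong₂; subst; subst₂; _→-setoid_)
open import Relation.Nullary.Negation using (¬_; contradiction)
open import Relation.Unary using (Pred; _∩_)

-- Pointwise equality, and concavity over the naturals.

permSetoid : ℕ → Setoid 0ℓ 0ℓ
permSetoid n = On.setoid {B = Permutation′ n} (Fin n →-setoid Fin n) _⟨$⟩ʳ_

infix 4 _∈_
_∈_ : ∀ {n} → Permutation′ n → List (Permutation′ n) → Set
_∈_ {n} = Membership._∈_ (permSetoid n)

-- The permutations are explicit because `π ≈ ρ` unfolds to equations between values, which do not
-- determine `π` and `ρ` by unification.
∈-resp : ∀ {n} {πs} (π ρ : Permutation′ n) → π ≈ ρ → π ∈ πs → ρ ∈ πs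
∈-resp π ρ π≈ρ = ∈-resp-≈ (permSetoid _) {x = π} {ρ} π≈ρ

∈-map : ∀ {m n} (f : Permutation′ m → Permutation′ n) →
  (∀ π ρ → π ≈ ρ → f π ≈ f ρ) → ∀ {πs} π → π ∈ πs → f π ∈ map f πs
∈-map f f-cong π = ∈-map⁺ (permSetoid _) (permSetoid _) (λ {π} {ρ} → f-cong π ρ) {v = π}

⟨$⟩ʳ-injective : ∀ {n} (π : Permutation′ n) {i j} → π ⟨$⟩ʳ i ≡ π ⟨$⟩ʳ j → i ≡ j
⟨$⟩ʳ-injective π eq =
  trans (sym (inverseˡ π)) (trans (cong (π ⟨$⟩ˡ_) eq) (inverseˡ π))

-- A record rather than a function type, so that `π` can be inferred from `Concave π`. Values count
-- from 0 here: adding 1 to all three terms adds 2 to both sides.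
record Concave {n} (π : Permutation′ n) : Set where
  field
    midpoint : ∀ h i j → toℕ i ≡ suc (toℕ h) → toℕ j ≡ suc (toℕ i) →
      toℕ (π ⟨$⟩ʳ h) + toℕ (π ⟨$⟩ʳ j) ≤ 2 * toℕ (π ⟨$⟩ʳ i)

open Concave

Concave-resp-≈ : ∀ {n} (π ρ : Permutation′ n) → π ≈ ρ → Concave π → Concave ρ
Concave-resp-≈ π ρ π≈ρ c .midpoint h i j hi ij =
  subst₂ _≤_ (cong₂ _+_ (cong toℕ (π≈ρ h)) (cong toℕ (π≈ρ j)))
             (cong (λ x → 2 * toℕ x) (π≈ρ i)) (c .midpoint h i j hi ij)

module _ (a b c : ℕ) where

  private
    sucs : suc a + suc c ≡ 2 + (a + c)
    sucs = cong suc (+-suc a c)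

  suc-midpoint⁺ : a + c ≤ 2 * b → suc a + suc c ≤ 2 * suc b
  suc-midpoint⁺ p =
    subst₂ _≤_ (sym sucs) (sym (*-suc 2 b)) (s≤s (s≤s p))

  suc-midpoint⁻ : suc a + suc c ≤ 2 * suc b → a + c ≤ 2 * b
  suc-midpoint⁻ p = s≤s⁻¹ (s≤s⁻¹ (subst₂ _≤_ sucs (*-suc 2 b) p))

  suc-midpoint-ℤ⁺ : a + c ≤ 2 * b →
    (+ suc a ℤ.+ + suc c) ℤ.- + 2 ℤ.* + suc b ℤ.≤ + 0
  suc-midpoint-ℤ⁺ p = ℤ.i≤j⇒i-j≤0 (+≤+ (suc-midpoint⁺ p))

  suc-midpoint-ℤ⁻ :
    (+ suc a ℤ.+ + suc c) ℤ.- + 2 ℤ.* + suc b ℤ.≤ + 0 → a + c ≤ 2 * b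
  suc-midpoint-ℤ⁻ p = suc-midpoint⁻ (ℤ.drop‿+≤+ (ℤ.i-j≤0⇒i≤j p))

SecondDifferences≤0⇒Concave : ∀ {n} (π : Permutation′ n) →
  SecondDifferences≤0 π → Concave π
SecondDifferences≤0⇒Concave π c .midpoint h i j hi ij =
  suc-midpoint-ℤ⁻ (toℕ (π ⟨$⟩ʳ h)) (toℕ (π ⟨$⟩ʳ i)) (toℕ (π ⟨$⟩ʳ j))
    (c h i j (cong suc hi) (cong suc ij))

Concave⇒SecondDifferences≤0 : ∀ {n} (π : Permutation′ n) →
  Concave π → SecondDifferences≤0 π
Concave⇒SecondDifferences≤0 π c h i j hi ij =
  suc-midpoint-ℤ⁺ (toℕ (π ⟨$⟩ʳ h)) (toℕ (π ⟨$⟩ʳ i)) (toℕ (π ⟨$⟩ʳ j))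
    (c .midpoint h i j (cong pred hi) (cong pred ij))

-- Reversal and prepending a 0.

mirror : ∀ {n} → Permutation′ n → Permutation′ n
mirror π = reverse ∘ₚ π

mirror-cong : ∀ {n} (π ρ : Permutation′ n) → π ≈ ρ → mirror π ≈ mirror ρ
mirror-cong π ρ π≈ρ i = π≈ρ (opposite i)

mirror-involutive : ∀ {n} (π : Permutation′ n) → mirror (mirror π) ≈ π
mirror-involutive π i = cong (π ⟨$⟩ʳ_) (opposite-involutive i)

mirror-injective : ∀ {n} (π ρ : Permutation′ n) → mirror π ≈ mirror ρ → π ≈ ρ
mirror-injective π ρ eq i = trans (sym (mirror-involutive π i))
  (trans (eq (opposite i)) (mirror-involutive ρ i))

opposite-step : ∀ {n} (h i : Fin n) → toℕ i ≡ suc (toℕ h) →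
  toℕ (opposite h) ≡ suc (toℕ (opposite i))
opposite-step zero (suc zero) refl = cong suc (sym (toℕ-inject₁ (fromℕ _)))
opposite-step (suc h) (suc i) eq = trans (toℕ-inject₁ _)
  (trans (opposite-step h i (cong pred eq)) (cong suc (sym (toℕ-inject₁ _))))

mirror-concave : ∀ {n} {π : Permutation′ n} → Concave π → Concave (mirror π)
mirror-concave {π = π} c .midpoint h i j hi ij =
  subst (_≤ 2 * toℕ (mirror π ⟨$⟩ʳ i))
    (+-comm (toℕ (mirror π ⟨$⟩ʳ j)) (toℕ (mirror π ⟨$⟩ʳ h)))
    (c .midpoint (opposite j) (opposite i) (opposite h)
       (opposite-step i j ij) (opposite-step h i hi))

-- The concavity condition at the first position of 0 ∷ (1 + π).
record SlowStart {n} (π : Permutation′ (2 + n)) : Set where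
  constructor slowStart
  field
    bound : toℕ (π ⟨$⟩ʳ suc zero) ≤ suc (2 * toℕ (π ⟨$⟩ʳ zero))

open SlowStart

SlowStart-resp-≈ : ∀ {n} (π ρ : Permutation′ (2 + n)) →
  π ≈ ρ → SlowStart π → SlowStart ρ
SlowStart-resp-≈ π ρ π≈ρ s .bound = subst₂ _≤_ (cong toℕ (π≈ρ (suc zero)))
  (cong (λ x → suc (2 * toℕ x)) (π≈ρ zero)) (s .bound)

lift₀-concave⁺ : ∀ {n} {π : Permutation′ (2 + n)} →
  Concave π → SlowStart π → Concave (lift₀ π)
lift₀-concave⁺ {π = π} c s .midpoint zero (suc zero) (suc (suc zero)) refl refl =
  subst (suc (toℕ (π ⟨$⟩ʳ suc zero)) ≤_) (sym (*-suc 2 (toℕ (π ⟨$⟩ʳ zero))))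
    (s≤s (s .bound))
lift₀-concave⁺ {π = π} c s .midpoint (suc h) (suc i) (suc j) hi ij =
  suc-midpoint⁺ (toℕ (π ⟨$⟩ʳ h)) (toℕ (π ⟨$⟩ʳ i)) (toℕ (π ⟨$⟩ʳ j))
    (c .midpoint h i j (cong pred hi) (cong pred ij))

lift₀-concave⁻ : ∀ {n} (π : Permutation′ n) → Concave (lift₀ π) → Concave π
lift₀-concave⁻ π c .midpoint h i j hi ij =
  suc-midpoint⁻ (toℕ (π ⟨$⟩ʳ h)) (toℕ (π ⟨$⟩ʳ i)) (toℕ (π ⟨$⟩ʳ j))
    (c .midpoint (suc h) (suc i) (suc j) (cong suc hi) (cong suc ij))

lift₀-slowStart : ∀ {n} (π : Permutation′ (2 + n)) →
  Concave (lift₀ π) → SlowStart π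
lift₀-slowStart π c .bound = s≤s⁻¹
  (subst (suc (toℕ (π ⟨$⟩ʳ suc zero)) ≤_) (*-suc 2 (toℕ (π ⟨$⟩ʳ zero)))
    (c .midpoint zero (suc zero) (suc (suc zero)) refl refl))

id-concave : ∀ {n} → Concave {n} id
id-concave .midpoint h i j hi ij rewrite ij | hi = ≤-reflexive (sum (toℕ h))
  where
  open +-*-Solver
  sum : ∀ k → k + suc (suc k) ≡ 2 * suc k
  sum = solve 1 (λ k → k :+ (con 2 :+ k) := con 2 :* (con 1 :+ k)) refl

-- The position of the value 0.

interior-value-≢0 : ∀ {n} (π : Permutation′ (suc n)) → Concave π → ∀ h i j →
  toℕ i ≡ suc (toℕ h) → toℕ j ≡ suc (toℕ i) → π ⟨$⟩ʳ i ≢ zero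
interior-value-≢0 π c h i j hi ij πi≡0 =
  1+n≰n (≤-reflexive (trans (sym hi) (cong toℕ i≡h)))
  where
  -- The neighbours' values sum to at most 2 * 0, so `h` carries 0 as well as `i`.
  sum≡0 : toℕ (π ⟨$⟩ʳ h) + toℕ (π ⟨$⟩ʳ j) ≡ 0
  sum≡0 = n≤0⇒n≡0 (subst (λ x → toℕ (π ⟨$⟩ʳ h) + toℕ (π ⟨$⟩ʳ j) ≤ 2 * toℕ x) πi≡0
    (c .midpoint h i j hi ij))

  i≡h : i ≡ h
  i≡h = ⟨$⟩ʳ-injective π
    (trans πi≡0 (sym (toℕ-injective (m+n≡0⇒m≡0 (toℕ (π ⟨$⟩ʳ h)) sum≡0))))

zero-at-end : ∀ {n} (π : Permutation′ (suc n)) → Concave π →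
  π ⟨$⟩ʳ zero ≡ zero ⊎ mirror π ⟨$⟩ʳ zero ≡ zero
zero-at-end π c = go (π ⟨$⟩ˡ zero) (inverseʳ π)
  where
  go : ∀ i → π ⟨$⟩ʳ i ≡ zero → π ⟨$⟩ʳ zero ≡ zero ⊎ mirror π ⟨$⟩ʳ zero ≡ zero
  go zero    πi≡0 = inj₁ πi≡0
  go (suc i) πi≡0 with view i
  -- The last position is `opposite zero`, so `πi≡0` is already the claim about `mirror π`.
  ... | ‵fromℕ     = inj₂ πi≡0
  ... | ‵inject₁ k = contradiction πi≡0
    (interior-value-≢0 π c (inject₁ (inject₁ k)) _ (suc (suc k))
      (cong suc (sym (toℕ-inject₁ _)))
      (cong (λ x → 2 + x) (sym (toℕ-inject₁ k))))

StartsAt0 : ∀ {n} → Pred (Permutation′ (suc n)) 0ℓ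
StartsAt0 π = π ⟨$⟩ʳ zero ≡ zero

-- Since `π` starts with 0, its second value is at most 1, so the remainder `ρ` starts with 0 too;
-- induct on the length.
slowStart⇒≈id : ∀ {n} (π : Permutation′ (2 + n)) →
  Concave π → StartsAt0 π → SlowStart π → π ≈ id
slowStart⇒≈id {n} π c π0 s i =
  trans (sym (lift₀-remove π π0 i))
    (trans (lift₀-cong ρ id (ρ≈id n ρ lift-c ρ0) i) (lift₀-id i))
  where
  ρ : Permutation′ (suc n)
  ρ = remove zero π

  lift-c : Concave (lift₀ ρ)
  lift-c = Concave-resp-≈ π (lift₀ ρ) (sym ∘ lift₀-remove π π0) c

  ρ0 : StartsAt0 ρ
  ρ0 = toℕ-injective (n≤0⇒n≡0 (s≤s⁻¹ (subst₂ _≤_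
    (cong toℕ (sym (lift₀-remove π π0 (suc zero))))
    (cong (λ x → suc (2 * toℕ x)) π0) (s .bound))))

  -- Concavity is assumed of `lift₀ ρ`, whose first inequality gives the slow start of `ρ` for the
  -- recursive call.
  ρ≈id : ∀ n (ρ : Permutation′ (suc n)) → Concave (lift₀ ρ) → StartsAt0 ρ → ρ ≈ id
  ρ≈id zero    ρ c ρ0 zero = ρ0
  ρ≈id (suc n) ρ c ρ0      =
    slowStart⇒≈id ρ (lift₀-concave⁻ ρ c) ρ0 (lift₀-slowStart ρ c)

-- Opaque, since comparing two unfolded permutations also compares their
-- inverse maps and the proofs stored in the records.
opaque

  0∷1+mirror : ∀ {n} → Permutation′ n → Permutation′ (suc n)
  0∷1+mirror π = lift₀ (mirror π)

opaque
  unfolding 0∷1+mirror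

  0∷1+mirror-cong : ∀ {n} (π ρ : Permutation′ n) →
    π ≈ ρ → 0∷1+mirror π ≈ 0∷1+mirror ρ
  0∷1+mirror-cong π ρ π≈ρ = lift₀-cong (mirror π) (mirror ρ) (mirror-cong π ρ π≈ρ)

  0∷1+mirror-injective : ∀ {n} (π ρ : Permutation′ n) →
    0∷1+mirror π ≈ 0∷1+mirror ρ → π ≈ ρ
  0∷1+mirror-injective π ρ eq = mirror-injective π ρ (suc-injective ∘ eq ∘ suc)

-- `inject₁ (opposite k)` is `opposite (suc k)` by definition, which reduces this to involutivity.
opposite-inject₁ : ∀ {n} (i : Fin n) → opposite (inject₁ i) ≡ suc (opposite i)
opposite-inject₁ i = trans
  (cong (opposite ∘ inject₁) (sym (opposite-involutive i)))
  (opposite-involutive (suc (opposite i)))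

opaque
  unfolding 0∷1+mirror

  mirror-0∷1+mirror : ∀ {n} (π : Permutation′ n) i →
    mirror (0∷1+mirror π) ⟨$⟩ʳ inject₁ i ≡ suc (π ⟨$⟩ʳ i)
  mirror-0∷1+mirror π i = trans
    (cong (0∷1+mirror π ⟨$⟩ʳ_) (opposite-inject₁ i))
    (cong suc (mirror-involutive π i))

module _ {n} (π : Permutation′ (2 + n)) where

  private
    π0 π1 : ℕ
    π0 = toℕ (π ⟨$⟩ʳ zero)
    π1 = toℕ (π ⟨$⟩ʳ suc zero)

    end₀ : toℕ (mirror (0∷1+mirror π) ⟨$⟩ʳ zero) ≡ suc π0
    end₀ = cong toℕ (mirror-0∷1+mirror π zero)

    end₁ : toℕ (mirror (0∷1+mirror π) ⟨$⟩ʳ suc zero) ≡ suc π1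
    end₁ = cong toℕ (mirror-0∷1+mirror π (suc zero))

  -- The reversal begins 1 + π0, 1 + π1, and 1 + π1 ≤ 1 + 2(1 + π0) simplifies to the stated bound.
  mirror-slowStart⁺ : π1 ≤ 2 + 2 * π0 → SlowStart (mirror (0∷1+mirror π))
  mirror-slowStart⁺ p .bound = subst₂ (λ a b → b ≤ suc (2 * a)) (sym end₀) (sym end₁)
    (s≤s (subst (π1 ≤_) (sym (*-suc 2 π0)) p))

  mirror-slowStart⁻ : SlowStart (mirror (0∷1+mirror π)) → π1 ≤ 2 + 2 * π0
  mirror-slowStart⁻ s = subst (π1 ≤_) (*-suc 2 π0)
    (s≤s⁻¹ (subst₂ (λ a b → b ≤ suc (2 * a)) end₀ end₁ (s .bound)))

mirror-id-slowStart : ∀ {n} → SlowStart {n} (mirror id)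
mirror-id-slowStart {n} .bound = ≤-trans
  (≤-trans (≤-reflexive (toℕ-inject₁ (fromℕ n))) (n≤1+n _))
  (≤-trans (m≤n*m (toℕ (fromℕ (suc n))) 2) (n≤1+n _))

-- Complete lists without repetition.

record Enumerates {n} (P : Pred (Permutation′ n) 0ℓ)
                  (πs : List (Permutation′ n)) : Set where
  field
    sound    : All P πs
    unique   : Unique (permSetoid n) πs
    complete : ∀ {π} → P π → π ∈ πs

open Enumerates

lookup-injective : ∀ {n} {πs : List (Permutation′ n)} → Unique (permSetoid n) πs →
  ∀ {i j} → lookup πs i ≈ lookup πs j → i ≡ j
lookup-injective (_ ∷ _)  {zero}  {zero}  eq = refl
lookup-injective (π∉ ∷ _) {zero}  {suc j} eq =
  contradiction eq (All.lookup π∉ (∈-lookup j))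
lookup-injective (π∉ ∷ _) {suc i} {zero}  eq =
  contradiction (sym ∘ eq) (All.lookup π∉ (∈-lookup i))
lookup-injective (_ ∷ u)  {suc i} {suc j} eq = cong suc (lookup-injective u eq)

enumeration⇒count : ∀ {n} {πs : List (Permutation′ n)} →
  Enumerates Concave πs → f₀[ n ]≐ length πs
enumeration⇒count {πs = πs} e = record
  { to        = λ i → lookup πs i ,
      Concave⇒SecondDifferences≤0 (lookup πs i) (All.lookup (sound e) (∈-lookup i))
  ; cong      = λ { refl _ → refl }
  ; bijective = lookup-injective (unique e) , λ (π , c) →
      let π∈πs = complete e (SecondDifferences≤0⇒Concave π c)
      in index π∈πs , λ { refl → sym ∘ lookup-index π∈πs }
  }

StartsAt0∧Concave : ∀ {n} → Pred (Permutation′ (suc n)) 0ℓ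
StartsAt0∧Concave = StartsAt0 ∩ Concave

opaque
  unfolding 0∷1+mirror

  -- The slow start of the reversal is what `lift₀-concave⁺` asks for. For completeness, strip the
  -- leading 0 and see at which end the remainder has its own 0.
  extend : ∀ {n} {πs : List (Permutation′ (2 + n))} →
    Enumerates (StartsAt0∧Concave ∩ (SlowStart ∘ mirror)) πs →
    Enumerates StartsAt0∧Concave (id ∷ map 0∷1+mirror πs)
  extend {n} {πs} e = record
    { sound    = (refl , id-concave) ∷ All.map⁺ (All.map
        (λ ((_ , c) , s) → refl , lift₀-concave⁺ (mirror-concave c) s) (sound e))
    ; unique   = All.map⁺ (All.map (λ {π} ((π0 , _) , _) → id≉ π π0) (sound e))
        ∷ Unique.map⁺ S T (λ {π} {ρ} → 0∷1+mirror-injective π ρ) (unique e)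
    ; complete = λ {π} (π0 , c) →
        let ρ = remove zero π; π≈ = sym ∘ lift₀-remove π π0 in
        ∈-resp (lift₀ ρ) π (sym ∘ π≈) (covers ρ (Concave-resp-≈ π (lift₀ ρ) π≈ c))
    }
    where
    S T : Setoid 0ℓ 0ℓ
    S = permSetoid (2 + n)
    T = permSetoid (3 + n)

    id≉ : ∀ (π : Permutation′ (2 + n)) → StartsAt0 π → ¬ (id ≈ 0∷1+mirror π)
    id≉ π π0 eq = contradiction
      -- Comparing entries at position 1 makes the last value of `π` equal to 0, which `π` already
      -- takes at `zero`.
      (⟨$⟩ʳ-injective π {zero} {fromℕ (suc n)} (trans π0 (suc-injective (eq (suc zero)))))
      λ ()

    covers : (ρ : Permutation′ (2 + n)) → Concave (lift₀ ρ) →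
      lift₀ ρ ∈ id ∷ map 0∷1+mirror πs
    covers ρ lift-c with lift₀-concave⁻ ρ lift-c | lift₀-slowStart ρ lift-c
    ... | c | s with zero-at-end ρ c
    ... | inj₁ ρ0 = here λ i →
      trans (lift₀-cong ρ id (slowStart⇒≈id ρ c ρ0 s) i) (lift₀-id i)
    -- `ρ` is the mirror of `mirror ρ`, so its slow start puts `mirror ρ` into `πs`.
    ... | inj₂ ρ0 = there (∈-resp (0∷1+mirror (mirror ρ)) (lift₀ ρ)
      (lift₀-cong (mirror (mirror ρ)) ρ (mirror-involutive ρ))
      (∈-map 0∷1+mirror 0∷1+mirror-cong (mirror ρ) (complete e ((ρ0 , mirror-concave c) ,
        SlowStart-resp-≈ ρ (mirror (mirror ρ)) (sym ∘ mirror-involutive ρ) s))))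

-- A permutation in both halves would yield a `ρ` with 0 at both ends, which are distinct positions
-- since the length is at least 2.
add-mirrors : ∀ {n} {πs : List (Permutation′ (2 + n))} →
  Enumerates StartsAt0∧Concave πs → Enumerates Concave (πs ++ map mirror πs)
add-mirrors {n} {πs} e = record
  { sound    = All.++⁺ (All.map proj₂ (sound e))
      (All.map⁺ (All.map (mirror-concave ∘ proj₂) (sound e)))
  ; unique   = Unique.++⁺ S (unique e)
      (Unique.map⁺ S S (λ {π} {ρ} → mirror-injective π ρ) (unique e))
      (λ {π} → disjoint {π})
  ; complete = λ {π} c → covers π c (zero-at-end π c)
  }
  where
  S : Setoid 0ℓ 0ℓ
  S = permSetoid (2 + n)

  starts : ∀ π → π ∈ πs → StartsAt0 π
  starts π = All.lookupₛ S {P = StartsAt0}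
    (λ {σ} {τ} σ≈τ σ0 → trans (sym (σ≈τ zero)) σ0) (All.map proj₁ (sound e)) {π}

  disjoint : Disjoint S πs (map mirror πs)
  disjoint {π} (π∈ , π∈mirrors) with ρ , ρ∈ , π≈ ← ∈-map⁻ S S {π} {f = mirror} π∈mirrors =
    contradiction
      (⟨$⟩ʳ-injective ρ {zero} {fromℕ (suc n)}
        (trans (starts ρ ρ∈) (trans (sym (starts π π∈)) (π≈ zero))))
      λ ()

  covers : ∀ π → Concave π → StartsAt0 π ⊎ StartsAt0 (mirror π) →
    π ∈ πs ++ map mirror πs
  covers π c (inj₁ π0) = ∈-++⁺ˡ S {π} (complete e (π0 , c))
  covers π c (inj₂ π0) = ∈-++⁺ʳ S {π} πs
    (∈-resp (mirror (mirror π)) π (mirror-involutive π)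
      (∈-map mirror mirror-cong (mirror π) (complete e (π0 , mirror-concave c))))

module _ {n} {P Q : Pred (Permutation′ n) 0ℓ} where

  restrict : ∀ {πs} → Enumerates P πs → All Q πs → Enumerates (P ∩ Q) πs
  restrict e q = record
    { sound    = All.zip (sound e , q)
    ; unique   = unique e
    ; complete = complete e ∘ proj₁
    }

  -- As `Q` respects `≈`, nothing satisfying `Q` can equal `γ`, so completeness survives its
  -- removal.
  restrict-drop-third : (∀ π ρ → π ≈ ρ → Q π → Q ρ) → ∀ {α β γ δ} →
    Enumerates P (α ∷ β ∷ γ ∷ δ ∷ []) → Q α → Q β → ¬ Q γ → Q δ →
    Enumerates (P ∩ Q) (α ∷ β ∷ δ ∷ [])
  restrict-drop-third resp {γ = γ} e qα qβ ¬qγ qδ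
    with pα ∷ pβ ∷ _ ∷ pδ ∷ [] ← sound e
    with (α≉β ∷ _ ∷ α≉δ ∷ []) ∷ (_ ∷ β≉δ ∷ []) ∷ _ ∷ u ← unique e = record
    { sound    = (pα , qα) ∷ (pβ , qβ) ∷ (pδ , qδ) ∷ []
    ; unique   = (α≉β ∷ α≉δ ∷ []) ∷ (β≉δ ∷ []) ∷ u
    ; complete = λ {π} (p , q) → case complete e p of λ where
        (here π≈α)                         → here π≈α
        (there (here π≈β))                 → there (here π≈β)
        (there (there (here π≈γ)))         → contradiction (resp π γ π≈γ q) ¬qγ
        (there (there (there (here π≈δ)))) → there (there (here π≈δ))
    }

-- The lists for lengths 1 to 4.

enumeration₁ : Enumerates {1} Concave (id ∷ [])
enumeration₁ = record
  { sound    = id-concave ∷ []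
  ; unique   = [] ∷ []
  ; complete = λ {π} _ → here λ { zero → Fin1 (π ⟨$⟩ʳ zero) }
  }
  where
  Fin1 : (i : Fin 1) → i ≡ zero
  Fin1 zero = refl

enumeration₂ : Enumerates {2} StartsAt0∧Concave (id ∷ [])
enumeration₂ = record
  { sound    = (refl , id-concave) ∷ []
  ; unique   = [] ∷ []
  ; complete = λ {π} (π0 , c) → here
      -- In length 2 every value is at most 1, which is within the bound.
      (slowStart⇒≈id π c π0 (slowStart (≤-trans (toℕ≤pred[n] (π ⟨$⟩ʳ suc zero)) (s≤s z≤n))))
  }

enumeration₃ : Enumerates {3} StartsAt0∧Concave (id ∷ 0∷1+mirror id ∷ [])
enumeration₃ = extend (restrict enumeration₂ (mirror-id-slowStart ∷ []))

mirror-0∷1+mirror-id-slowStart : ∀ {n} → SlowStart {suc n} (mirror (0∷1+mirror id))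
mirror-0∷1+mirror-id-slowStart = mirror-slowStart⁺ id (s≤s z≤n)

enumeration₄ : Enumerates {4} StartsAt0∧Concave
  (id ∷ 0∷1+mirror id ∷ 0∷1+mirror (0∷1+mirror id) ∷ [])
enumeration₄ = extend (restrict enumeration₃
  (mirror-id-slowStart ∷ mirror-0∷1+mirror-id-slowStart ∷ []))

-- The stable list from length 5 on.

opaque
  unfolding 0∷1+mirror

  -- `0∷1+mirror id` has length 4 + n here and begins 0, 3 + n, while the bound is 2.
  ¬mirror-0∷1+mirror²-id-slowStart : ∀ {n} →
    ¬ SlowStart {3 + n} (mirror (0∷1+mirror (0∷1+mirror id)))
  ¬mirror-0∷1+mirror²-id-slowStart s
    with s≤s (s≤s ()) ← mirror-slowStart⁻ (0∷1+mirror id) s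

  -- `0∷1+mirror ω` begins with 0 and 1 plus the last value of `ω`; the bound is again 2.
  mirror-0∷1+mirror²-slowStart : ∀ {n} (ω : Permutation′ (1 + n)) →
    toℕ (mirror ω ⟨$⟩ʳ zero) ≤ 1 → SlowStart (mirror (0∷1+mirror (0∷1+mirror ω)))
  mirror-0∷1+mirror²-slowStart ω ωₗ = mirror-slowStart⁺ (0∷1+mirror ω) (s≤s ωₗ)

  0∷1+mirror-startsAt0 : ∀ {n} (π : Permutation′ n) → StartsAt0 (0∷1+mirror π)
  0∷1+mirror-startsAt0 π = refl

-- Dropping the third entry and extending gives the same shape, with `0∷1+mirror ω` in place of `ω`.
spine : ∀ {m} → Permutation′ (3 + m) → List (Permutation′ (5 + m))
spine ω = id ∷ 0∷1+mirror id ∷ 0∷1+mirror (0∷1+mirror id) ∷ 0∷1+mirror (0∷1+mirror ω) ∷ []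

enumeration₅ : Enumerates {5} StartsAt0∧Concave (spine {0} (0∷1+mirror id))
enumeration₅ = extend (restrict enumeration₄
  (mirror-id-slowStart ∷ mirror-0∷1+mirror-id-slowStart ∷
   -- This `id` has length 2 and last value 1, so the bound holds with equality.
   mirror-0∷1+mirror²-slowStart id (s≤s z≤n) ∷ []))

extend-spine : ∀ {m} (ω : Permutation′ (3 + m)) → toℕ (mirror ω ⟨$⟩ʳ zero) ≤ 1 →
  Enumerates {5 + m} StartsAt0∧Concave (spine ω) →
  Enumerates {6 + m} StartsAt0∧Concave (spine (0∷1+mirror ω))
extend-spine {m} ω ωₗ e = extend (restrict-drop-third
  (λ π ρ → SlowStart-resp-≈ (mirror π) (mirror ρ) ∘ mirror-cong π ρ) e
  mirror-id-slowStart
  mirror-0∷1+mirror-id-slowStart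
  ¬mirror-0∷1+mirror²-id-slowStart
  (mirror-0∷1+mirror²-slowStart ω ωₗ))

-- ω is the zigzag of length 3 + m.
enumeration₅₊ : ∀ m → Σ (Permutation′ (3 + m)) λ ω →
  StartsAt0 ω × toℕ (mirror ω ⟨$⟩ʳ zero) ≤ 1 ×
  Enumerates {5 + m} StartsAt0∧Concave (spine ω)
enumeration₅₊ zero =
  0∷1+mirror id , 0∷1+mirror-startsAt0 id ,
  ≤-reflexive (cong toℕ (mirror-0∷1+mirror id zero)) , enumeration₅
enumeration₅₊ (suc m) = let ω , ω0 , ωₗ , e = enumeration₅₊ m in
  0∷1+mirror ω , 0∷1+mirror-startsAt0 ω ,
  -- The last value of `0∷1+mirror ω` is 1 plus the first value of `ω`, hence 1.
  ≤-reflexive (cong toℕ (trans (mirror-0∷1+mirror ω zero) (cong suc ω0))) ,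
  extend-spine ω ωₗ e

theorem3p7 : ∀ (n : ℕ) → n ≥ 1 →
    (n ≡ 1 → f₀[ n ]≐ 1) ×
    (n ≡ 2 → f₀[ n ]≐ 2) ×
    (n ≡ 3 → f₀[ n ]≐ 4) ×
    (n ≡ 4 → f₀[ n ]≐ 6) ×
    (n ≥ 5 → f₀[ n ]≐ 8)
theorem3p7 n _ =
  -- In length 1 the identity is its own reversal, so no mirrors are added.
  (λ { refl → enumeration⇒count enumeration₁ }) ,
  (λ { refl → enumeration⇒count (add-mirrors enumeration₂) }) ,
  (λ { refl → enumeration⇒count (add-mirrors enumeration₃) }) ,
  (λ { refl → enumeration⇒count (add-mirrors enumeration₄) }) ,
  (λ { (s≤s (s≤s (s≤s (s≤s (s≤s {n = m} z≤n))))) →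
       enumeration⇒count (add-mirrors (proj₂ (proj₂ (proj₂ (enumeration₅₊ m))))) })
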